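{- $n_6(4) \leq 66$; that is, there exists a graph on $66$ vertices with chromatic number $4$ and girth at least $6$.
   Context: All graphs are finite and simple. The girth of a graph is the length of its shortest cycle. For integers $g$ and $k$, $n_g(k)$ denotes the smallest order of a graph with chromatic number exactly $k$ and girth at least $g$. -}

module Defs where

open import Data.Nat using (ℕ; suc; _<_; _≤_; _<?_)
open import Data.Fin using (Fin; zero; suc; toℕ; fromℕ<)
open import Data.Product using (Σ; _×_; ∃)
open import Data.Empty using (⊥)
open import Relation.Nullary using (¬_; yes; no)
open import Relation.Binary.PropositionalEquality using (_≡_)
open import Function.Definitions using (Injective)

record Graph (n : ℕ) : Set₁ where
  field
    Adj     : Fin n → Fin n → Set
    irrefl  : ∀ v → ¬ Adj v v
    sym     : ∀ u v → Adj u v → Adj v u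

open Graph public

ProperColouring : ∀ {n} → Graph n → ℕ → Set
ProperColouring {n} G k =
  Σ (Fin n → Fin k) λ c → ∀ u v → Adj G u v → ¬ (c u ≡ c v)

Colourable : ∀ {n} → Graph n → ℕ → Set
Colourable G k = ProperColouring G k

ChromaticNumber : ∀ {n} → Graph n → ℕ → Set
ChromaticNumber G k = Colourable G k × (∀ m → m < k → ¬ Colourable G m)

next : ∀ {k} → Fin (suc k) → Fin (suc k)
next {k} i with toℕ i <? k
... | yes p = suc (fromℕ< p)
... | no _  = zero

Cycle : ∀ {n} → Graph n → ℕ → Set
Cycle {n} G 0       = ⊥
Cycle {n} G (suc k) =
  Σ (Fin (suc k) → Fin n) λ v → Injective _≡_ _≡_ v × (∀ i → Adj G (v i) (v (next i)))

-- girth at least g: no cycle of length ℓ with 3 ≤ ℓ < g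
-- (acyclic graphs have infinite girth and satisfy this for every g).
GirthAtLeast : ∀ {n} → Graph n → ℕ → Set
GirthAtLeast G g = ∀ ℓ → 3 ≤ ℓ → ℓ < g → ¬ Cycle G ℓ

{-# OPTIONS --safe #-}
-- The graph is a lift along ℤ/11 of a multigraph with loops on six vertices, found
-- by computer search.  Cycles of length 3, 4 and 5 are excluded by following all
-- non-backtracking walks.  A backtracking search that always branches on a most
-- constrained vertex decides that there is no 3-colouring; it needs about 28000
-- assignments because the colours of two adjacent vertices are fixed in advance,
-- which a permutation of the colours allows.
module Submission where

open import Defs hiding (sym)
open import Data.Bool using (Bool; true; false; if_then_else_; T)
open import Data.Bool.ListAction using (all)
open import Data.Bool.Properties using (T-≡)
open import Data.Fin using (Fin; zero; suc; toℕ; #_; inject≤)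
open import Data.Fin.Properties using (all?; _≟_; toℕ-injective; inject≤-injective)
open import Data.List using (List; []; _∷_; map; filter; allFin; length)
open import Data.List.Membership.Propositional using (_∈_)
open import Data.List.Membership.Propositional.Properties using (∈-filter⁺; ∈-allFin)
open import Data.List.Relation.Unary.All using (All)
open import Data.List.Relation.Unary.All.Properties using (all⁺)
open import Data.List.Relation.Unary.Any using (here)
open import Data.Maybe using (Maybe; just; nothing; maybe′; is-just; _<∣>_)
open import Data.Nat using (ℕ; zero; suc; _+_; _*_; _≤_; _<ᵇ_; s≤s; s≤s⁻¹)
open import Data.Nat.DivMod using (_/_; _%_)
open import Data.Product using (Σ; _×_; _,_)
open import Data.Vec using (Vec; []; _∷_; lookup; zipWith; tabulate; replicate; _[_]≔_)
open import Data.Vec.Properties using (lookup-zipWith; lookup∘tabulate; lookup-replicate; lookup∘update; lookup∘update′)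
open import Function using (_∘_; Equivalence)
open import Function.Definitions using (Injective)
open import Relation.Binary.PropositionalEquality using (_≡_; _≢_; refl; sym; cong; subst; module ≡-Reasoning)
open import Relation.Nullary using (¬_; Dec; yes; no; does)
open import Relation.Nullary.Decidable using (¬?; _→-dec_)
import Data.List.Membership.DecPropositional as DecMembership
import Data.List.Relation.Unary.All as All
import Data.Maybe as Maybe
import Data.Maybe.Relation.Unary.All as MaybeAll
import Data.Nat as ℕ

open DecMembership ℕ._≟_ using (_∈?_)

-- Evaluating `does d` against `refl` is much faster for the type checker than
-- evaluating it in the type `True d`.
decided : ∀ {p} {P : Set p} (d : Dec P) → does d ≡ true → P
decided (yes p) _ = p

-- Backtracking search for colourings.

-- The domain of a vertex is `nothing` once the vertex has been coloured.
Domain : ℕ → Set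
Domain k = Maybe (List (Fin k))

firstSuchThat : ∀ {A : Set} {n} → (A → Bool) → Vec A n → Maybe (Fin n)
firstSuchThat p []       = nothing
firstSuchThat p (x ∷ xs) = if p x then just zero else Maybe.map suc (firstSuchThat p xs)

size< : ∀ {k} → ℕ → Domain k → Bool
size< m = maybe′ (λ xs → length xs <ᵇ m) false

-- Empty domains count as size below 2; branching on one closes the node at once, as `all` over no
-- colours is `true`.
mostConstrained : ∀ {n k} → Vec (Domain k) n → Maybe (Fin n)
mostConstrained ds =
  firstSuchThat (size< 2) ds <∣> firstSuchThat (size< 3) ds <∣> firstSuchThat is-just ds

exclude : ∀ {k} → Fin k → Bool → Domain k → Domain k
exclude x false d = d
exclude x true  d = Maybe.map (filter (λ y → ¬? (x ≟ y))) d

module Backtracking {n k : ℕ} (adjacency : Vec (Vec Bool n) n) where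

  assign : Fin n → Fin k → Vec (Domain k) n → Vec (Domain k) n
  assign i x ds = zipWith (exclude x) (lookup adjacency i) (ds [ i ]≔ nothing)

  refute         : ℕ → Vec (Domain k) n → Bool
  refuteAt       : ℕ → Vec (Domain k) n → Maybe (Fin n) → Bool
  refuteBranches : ℕ → Vec (Domain k) n → Fin n → Domain k → Bool

  -- Exhausted fuel answers `false`, so that only `true` is a claim.
  refute zero       ds = false
  refute (suc fuel) ds = refuteAt fuel ds (mostConstrained ds)

  refuteAt fuel ds nothing  = false
  refuteAt fuel ds (just i) = refuteBranches fuel ds i (lookup ds i)

  refuteBranches fuel ds i nothing   = false
  refuteBranches fuel ds i (just xs) = all (λ x → refute fuel (assign i x ds)) xs

  module Soundness
    (c : Fin n → Fin k)
    (proper : ∀ i j → lookup (lookup adjacency i) j ≡ true → c i ≢ c j)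
    where

    -- Coloured vertices impose no condition: past choices persist only through the colours struck
    -- from their neighbours.
    Consistent : Vec (Domain k) n → Set
    Consistent ds = ∀ j → MaybeAll.All (c j ∈_) (lookup ds j)

    update-consistent : ∀ {ds} i {d} → MaybeAll.All (c i ∈_) d → Consistent ds → Consistent (ds [ i ]≔ d)
    update-consistent {ds} i {d} ci∈d con j with j ≟ i
    ... | yes refl = subst (MaybeAll.All (c i ∈_)) (sym (lookup∘update i ds d)) ci∈d
    ... | no  j≢i  = subst (MaybeAll.All (c j ∈_)) (sym (lookup∘update′ j≢i ds d)) (con j)

    exclude-consistent : ∀ {i j} b {d} → (b ≡ true → c i ≢ c j) →
                         MaybeAll.All (c j ∈_) d → MaybeAll.All (c j ∈_) (exclude (c i) b d)
    exclude-consistent false _     cj∈d              = cj∈d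
    exclude-consistent true  ci≢cj MaybeAll.nothing     = MaybeAll.nothing
    exclude-consistent true  ci≢cj (MaybeAll.just cj∈d) = MaybeAll.just (∈-filter⁺ _ cj∈d (ci≢cj refl))

    assign-consistent : ∀ {ds} i → Consistent ds → Consistent (assign i (c i) ds)
    assign-consistent {ds} i con j =
      subst (MaybeAll.All (c j ∈_))
        (sym (lookup-zipWith (exclude (c i)) j (lookup adjacency i) (ds [ i ]≔ nothing)))
        (exclude-consistent (lookup (lookup adjacency i) j) (proper i j)
          (update-consistent {ds} i MaybeAll.nothing con j))

    -- At each vertex `i` the branch with colour `c i` stays consistent with `c`; following these
    -- branches ends in an answer `false`.
    refute-sound         : ∀ fuel ds → Consistent ds → ¬ T (refute fuel ds)
    refuteAt-sound       : ∀ fuel ds → Consistent ds → ∀ mi → ¬ T (refuteAt fuel ds mi)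
    refuteBranches-sound : ∀ fuel ds → Consistent ds → ∀ i {d} → MaybeAll.All (c i ∈_) d →
                           ¬ T (refuteBranches fuel ds i d)

    refute-sound (suc fuel) ds con = refuteAt-sound fuel ds con (mostConstrained ds)

    refuteAt-sound fuel ds con (just i) = refuteBranches-sound fuel ds con i (con i)

    refuteBranches-sound fuel ds con i (MaybeAll.just {xs} ci∈xs) refuted =
      refute-sound fuel (assign i (c i) ds) (assign-consistent {ds} i con)
        (All.lookup (all⁺ (λ x → refute fuel (assign i x ds)) xs refuted) ci∈xs)

    -- Unlike `refute-sound`, this can be applied to a closed instance without
    -- the type checker evaluating the search a second time.
    consistent⇒unrefuted : ∀ fuel ds → Consistent ds → refute fuel ds ≢ true
    consistent⇒unrefuted fuel ds con = refute-sound fuel ds con ∘ Equivalence.from T-≡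

-- Normalising the colours of one edge.

recolour : Fin 3 → Fin 3 → Fin 3 → Fin 3
recolour a b x = if does (x ≟ a) then # 0 else if does (x ≟ b) then # 1 else # 2

recolour-fst : ∀ a b → recolour a b a ≡ # 0
recolour-fst = decided (all? λ a → all? λ b → recolour a b a ≟ # 0) refl

recolour-snd : ∀ a b → a ≢ b → recolour a b b ≡ # 1
recolour-snd = decided (all? λ a → all? λ b → ¬? (a ≟ b) →-dec recolour a b b ≟ # 1) refl

-- For `a ≢ b` the map is a permutation of the colours, so it preserves properness.
recolour-injective : ∀ a b → a ≢ b → ∀ x y → recolour a b x ≡ recolour a b y → x ≡ y
recolour-injective = decided
  (all? λ a → all? λ b → ¬? (a ≟ b) →-dec
    all? λ x → all? λ y → recolour a b x ≟ recolour a b y →-dec x ≟ y) refl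

-- The lifted graph.

-- The vertex 11 p + a lies over the vertex p of the base graph; (q , s) in row p
-- joins 11 p + a to 11 q + ((a + s) mod 11), and the row of q contains (p , - s).
arcs : ℕ → List (ℕ × ℕ)
arcs 0 = (0 , 3) ∷ (0 , 8) ∷ (4 , 2) ∷ (4 , 3)  ∷ (5 , 0)  ∷ []
arcs 1 = (2 , 4) ∷ (3 , 2) ∷ (3 , 6) ∷ (4 , 0)  ∷ (5 , 4)  ∷ []
arcs 2 = (1 , 7) ∷ (2 , 2) ∷ (2 , 9) ∷ (3 , 8)  ∷ (4 , 1)  ∷ []
arcs 3 = (1 , 5) ∷ (1 , 9) ∷ (2 , 3) ∷ (4 , 7)  ∷ (5 , 10) ∷ []
arcs 4 = (0 , 8) ∷ (0 , 9) ∷ (1 , 0) ∷ (2 , 10) ∷ (3 , 4)  ∷ []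
arcs 5 = (0 , 0) ∷ (1 , 7) ∷ (3 , 1) ∷ (5 , 2)  ∷ (5 , 9)  ∷ []
arcs _ = []

neighbours : ℕ → List ℕ
neighbours m = map (λ (q , s) → 11 * q + (m + s) % 11) (arcs (m / 11))

Adjacent : Fin 66 → Fin 66 → Set
Adjacent u v = toℕ v ∈ neighbours (toℕ u)

adjacent? : ∀ u v → Dec (Adjacent u v)
adjacent? u v = toℕ v ∈? neighbours (toℕ u)

-- Running over the lists leaves 330 arcs to check instead of all pairs of vertices.
neighbours-symmetric : ∀ (u : Fin 66) → All (λ m → toℕ u ∈ neighbours m) (neighbours (toℕ u))
neighbours-symmetric = decided
  (all? λ u → All.all? (λ m → toℕ u ∈? neighbours m) (neighbours (toℕ u))) refl

liftedGraph : Graph 66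
liftedGraph = record
  { Adj    = Adjacent
  ; irrefl = decided (all? λ u → ¬? (adjacent? u u)) refl
  ; sym    = λ u v → All.lookup (neighbours-symmetric u)
  }

-- Girth.

-- No walk starting with p , x and making k further steps without turning back ends in s.
Avoids : ℕ → ℕ → ℕ → ℕ → Set
Avoids zero    s p x = x ≢ s
Avoids (suc k) s p x = All (λ y → y ≢ p → Avoids k s x y) (neighbours x)

avoids? : ∀ k s p x → Dec (Avoids k s p x)
avoids? zero    s p x = ¬? (x ℕ.≟ s)
avoids? (suc k) s p x = All.all? (λ y → ¬? (y ℕ.≟ p) →-dec avoids? k s x y) (neighbours x)

-- The first edge is not counted in `k`, so the closed walks excluded have length `k + 1`.
NoClosedWalk : ℕ → Set
NoClosedWalk k = ∀ (u : Fin 66) → All (Avoids k (toℕ u) (toℕ u)) (neighbours (toℕ u))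

noClosedWalk? : ∀ k → Dec (NoClosedWalk k)
noClosedWalk? k = all? λ u → All.all? (avoids? k (toℕ u) (toℕ u)) (neighbours (toℕ u))

noClosedWalk₃ : NoClosedWalk 2
noClosedWalk₃ = decided (noClosedWalk? 2) refl

noClosedWalk₄ : NoClosedWalk 3
noClosedWalk₄ = decided (noClosedWalk? 3) refl

noClosedWalk₅ : NoClosedWalk 4
noClosedWalk₅ = decided (noClosedWalk? 4) refl

module CycleWalk {ℓ : ℕ} (v : Fin ℓ → Fin 66) (injective : Injective _≡_ _≡_ v) where

  first : ∀ {k} → NoClosedWalk k → ∀ i j → Adjacent (v i) (v j) →
          Avoids k (toℕ (v i)) (toℕ (v i)) (toℕ (v j))
  first none i j = All.lookup (none (v i))

  -- Distinct positions `h` and `j` on the cycle carry distinct vertices, so the walk does not turn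
  -- back.
  step : ∀ {k s} h i j → h ≢ j → Avoids (suc k) s (toℕ (v h)) (toℕ (v i)) → Adjacent (v i) (v j) →
         Avoids k s (toℕ (v i)) (toℕ (v j))
  step h i j h≢j avoids vi~vj = All.lookup avoids vi~vj (h≢j ∘ sym ∘ injective ∘ toℕ-injective)

girth≥6 : GirthAtLeast liftedGraph 6
girth≥6 1 (s≤s ())
girth≥6 2 (s≤s (s≤s ()))
girth≥6 3 _ _ (v , injective , adj) =
  -- Read from the inside out, the walk follows the cycle; its last edge returns to `v (# 0)`, and
  -- `refl` contradicts `Avoids zero`.
  step (# 1) (# 2) (# 0) (λ ()) (
  step (# 0) (# 1) (# 2) (λ ()) (
  first noClosedWalk₃ (# 0) (# 1) (adj (# 0))) (adj (# 1))) (adj (# 2)) refl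
  where open CycleWalk v injective
girth≥6 4 _ _ (v , injective , adj) =
  step (# 2) (# 3) (# 0) (λ ()) (
  step (# 1) (# 2) (# 3) (λ ()) (
  step (# 0) (# 1) (# 2) (λ ()) (
  first noClosedWalk₄ (# 0) (# 1) (adj (# 0))) (adj (# 1))) (adj (# 2))) (adj (# 3)) refl
  where open CycleWalk v injective
girth≥6 5 _ _ (v , injective , adj) =
  step (# 3) (# 4) (# 0) (λ ()) (
  step (# 2) (# 3) (# 4) (λ ()) (
  step (# 1) (# 2) (# 3) (λ ()) (
  step (# 0) (# 1) (# 2) (λ ()) (
  first noClosedWalk₅ (# 0) (# 1) (adj (# 0))) (adj (# 1))) (adj (# 2))) (adj (# 3))) (adj (# 4)) refl
  where open CycleWalk v injective
girth≥6 (suc (suc (suc (suc (suc (suc _)))))) _ (s≤s (s≤s (s≤s (s≤s (s≤s (s≤s ()))))))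

-- Four colours suffice.

fourColouring : Vec (Fin 4) 66
fourColouring =
    -- Each row is the fibre over one base vertex.
    r ∷ r ∷ g ∷ g ∷ g ∷ r ∷ r ∷ r ∷ g ∷ g ∷ b ∷
    b ∷ g ∷ b ∷ b ∷ g ∷ b ∷ b ∷ r ∷ g ∷ r ∷ g ∷
    b ∷ b ∷ g ∷ r ∷ r ∷ b ∷ g ∷ r ∷ r ∷ g ∷ g ∷
    g ∷ w ∷ g ∷ r ∷ g ∷ w ∷ r ∷ r ∷ r ∷ g ∷ b ∷
    r ∷ r ∷ g ∷ w ∷ b ∷ w ∷ r ∷ b ∷ b ∷ b ∷ b ∷
    g ∷ b ∷ b ∷ r ∷ r ∷ b ∷ g ∷ g ∷ b ∷ r ∷ r ∷ []
  where
  r g b w : Fin 4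
  r = # 0
  g = # 1
  b = # 2
  w = # 3

fourColourable : Colourable liftedGraph 4
fourColourable = lookup fourColouring , decided
  (all? λ u → all? λ v → adjacent? u v →-dec ¬? (lookup fourColouring u ≟ lookup fourColouring v)) refl

-- Three colours do not suffice.

adjacencyRow : Fin 66 → Vec Bool 66
adjacencyRow u = tabulate λ v → does (adjacent? u v)

adjacencyMatrix : Vec (Vec Bool 66) 66
adjacencyMatrix = tabulate adjacencyRow

adjacencyMatrix-sound : ∀ u v → lookup (lookup adjacencyMatrix u) v ≡ true → Adjacent u v
adjacencyMatrix-sound u v entry = decided (adjacent? u v) (begin
  does (adjacent? u v)                 ≡⟨ lookup∘tabulate (does ∘ adjacent? u) v ⟨
  lookup (adjacencyRow u) v            ≡⟨ cong (λ row → lookup row v) (lookup∘tabulate adjacencyRow u) ⟨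
  lookup (lookup adjacencyMatrix u) v  ≡⟨ entry ⟩
  true                                 ∎)
  where open ≡-Reasoning

-- The arc `(5 , 0)` joins vertices 0 and 55. Their fixed colours enter as singleton domains, so the
-- search itself propagates them.
start : Vec (Domain 3) 66
start = (replicate 66 (just (allFin 3)) [ # 0 ]≔ just (# 0 ∷ [])) [ # 55 ]≔ just (# 1 ∷ [])

-- Each level colours one more of the 66 vertices, so fuel 67 never runs out.
start-refuted : Backtracking.refute adjacencyMatrix 67 start ≡ true
start-refuted = refl

¬threeColourable : ¬ Colourable liftedGraph 3
¬threeColourable (c , proper) =
  consistent⇒unrefuted 67 start start-consistent start-refuted
  where
  c₀≢c₅₅ : c (# 0) ≢ c (# 55)
  c₀≢c₅₅ = proper (# 0) (# 55) (decided (adjacent? (# 0) (# 55)) refl)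

  c′ : Fin 66 → Fin 3
  c′ = recolour (c (# 0)) (c (# 55)) ∘ c

  c′-proper : ∀ u v → lookup (lookup adjacencyMatrix u) v ≡ true → c′ u ≢ c′ v
  c′-proper u v entry =
    proper u v (adjacencyMatrix-sound u v entry) ∘ recolour-injective _ _ c₀≢c₅₅ (c u) (c v)

  open Backtracking.Soundness adjacencyMatrix c′ c′-proper

  full-consistent : Consistent (replicate 66 (just (allFin 3)))
  full-consistent j =
    subst (MaybeAll.All (c′ j ∈_)) (sym (lookup-replicate j (just (allFin 3)))) (MaybeAll.just (∈-allFin (c′ j)))

  start-consistent : Consistent start
  start-consistent =
    update-consistent {replicate 66 (just (allFin 3)) [ # 0 ]≔ just (# 0 ∷ [])} (# 55)
      (MaybeAll.just (here (recolour-snd (c (# 0)) (c (# 55)) c₀≢c₅₅)))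
      (update-consistent {replicate 66 (just (allFin 3))} (# 0)
        (MaybeAll.just (here (recolour-fst (c (# 0)) (c (# 55))))) full-consistent)

-- Reduces every `m < 4` to the case of three colours.
colourable-mono : ∀ {n} {G : Graph n} {k m} → k ≤ m → Colourable G k → Colourable G m
colourable-mono k≤m (c , proper) =
  (λ u → inject≤ (c u) k≤m) , λ u v u~v → proper u v u~v ∘ inject≤-injective k≤m k≤m (c u) (c v)

theorem6 : Σ (Graph 66) λ G → ChromaticNumber G 4 × GirthAtLeast G 6
theorem6 =
  liftedGraph ,
  (fourColourable , λ m m<4 → ¬threeColourable ∘ colourable-mono {G = liftedGraph} (s≤s⁻¹ m<4)) ,
  girth≥6
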